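{- Let $h(t)$ be a reciprocal polynomial of degree $n$, and let $\gamma(u)=\sum_{r\ge0}\gamma_ru^r$ be the unique polynomial of degree at most $\lfloor n/2\rfloor$ such that $h(t)=(1+t)^n\,\gamma\!\left(\frac{t}{(1+t)^2}\right)$. Let $J(v)=\frac{h(v)}{(1+v)^n}$, regarded as a formal power series in $v$. Then for every integer $r\ge 1$, $$r\,\gamma_r=[u^{r-1}]\;J'(u)\,(u+1)^{2r}.$$
   Context: A polynomial $h$ of degree $n$ (with, say, real coefficients) is reciprocal if $t^nh(1/t)=h(t)$. For such $h$ a unique polynomial $\gamma$ of degree at most $\lfloor n/2\rfloor$ with $h(t)=(1+t)^n\gamma(t/(1+t)^2)$ exists. $[u^a]F(u)$ denotes the coefficient of $u^a$ in the power series $F(u)$, and $J'$ is the formal derivative of $J$. -}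

module Defs where

open import Algebra.Bundles using (CommutativeRing; Semiring)
open import Algebra.Bundles.Raw using (RawSemiring)
import Algebra.Definitions.RawSemiring as RawSemiringDefs
import Algebra.Properties.Semiring.Sum as SemiringSum
open import Data.Fin.Base using (Fin; toℕ)
open import Data.List.Base using (List; []; _∷_)
open import Data.Nat.Base as ℕ using (ℕ; zero; suc; _∸_; ⌊_/2⌋)
open import Data.Product.Base using (_×_)
open import Level using (Level)
import Relation.Binary.Reasoning.Setoid as SetoidReasoning

module PowerSeries {c ℓ : Level} (R : CommutativeRing c ℓ) where

  open CommutativeRing R hiding (zero)
  -- n · x is the n-fold sum x + ⋯ + x.
  open RawSemiringDefs (Semiring.rawSemiring semiring)
    using () renaming (_×_ to infixr 8 _·_) public
  open SemiringSum semiring using (sum; sum-cong-≋; sum-replicate-zero)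

  -- The formal power series with coefficients f 0, f 1, f 2, …
  Series : Set c
  Series = ℕ → Carrier

  infix  4 _≋_
  infixl 6 _+ₛ_
  infixl 7 _*ₛ_

  _≋_ : Series → Series → Set ℓ
  f ≋ g = ∀ k → f k ≈ g k

  _+ₛ_ : Series → Series → Series
  (f +ₛ g) k = f k + g k

  _*ₛ_ : Series → Series → Series
  (f *ₛ g) k = sum {suc k} (λ i → f (toℕ i) * g (k ∸ toℕ i))

  const : Carrier → Series
  const a zero    = a
  const a (suc _) = 0#

  0ₛ 1ₛ X : Series
  0ₛ _ = 0#
  1ₛ   = const 1#
  X zero    = 0#
  X (suc k) = 1ₛ k

  seriesRawSemiring : RawSemiring c ℓ
  seriesRawSemiring = record
    { Carrier = Series
    ; _≈_     = _≋_
    ; _+_     = _+ₛ_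
    ; _*_     = _*ₛ_
    ; 0#      = 0ₛ
    ; 1#      = 1ₛ
    }

  open RawSemiringDefs seriesRawSemiring
    using () renaming (_^_ to infixr 8 _^ₛ_; sum to sumₛ) public

  deriv : Series → Series
  deriv f k = suc k · f (suc k)

  1/[1+X] : Series
  1/[1+X] zero    = 1#
  1/[1+X] (suc k) = - 1/[1+X] k

  1+X-inverse : (1ₛ +ₛ X) *ₛ 1/[1+X] ≋ 1ₛ
  1+X-inverse zero = trans (+-identityʳ _) (trans (*-identityʳ _) (+-identityʳ 1#))
  1+X-inverse (suc k) = begin
    (1# + 0#) * (- g) + ((0# + 1#) * g + sum rest)
      ≈⟨ +-cong (trans (*-congʳ (+-identityʳ 1#)) (*-identityˡ _))
                (+-cong (trans (*-congʳ (+-identityˡ 1#)) (*-identityˡ g)) rest≈0) ⟩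
    - g + (g + 0#)  ≈⟨ +-congˡ (+-identityʳ g) ⟩
    - g + g         ≈⟨ -‿inverseˡ g ⟩
    0#              ∎
    where
    open SetoidReasoning setoid
    g : Carrier
    g = 1/[1+X] k
    rest : Fin k → Carrier
    rest i = (0# + 0#) * 1/[1+X] (k ∸ suc (toℕ i))
    rest≈0 : sum rest ≈ 0#
    rest≈0 = trans
      (sum-cong-≋ {k} (λ i → trans (*-congʳ (+-identityʳ 0#)) (zeroˡ (1/[1+X] (k ∸ suc (toℕ i))))))
      (sum-replicate-zero k)

  -- Coefficient lists, constant term first; trailing zeros are allowed, so
  -- the length of the list says nothing about the degree.
  Poly : Set c
  Poly = List Carrier

  coeff : Poly → Series
  coeff []      _       = 0#
  coeff (a ∷ p) zero    = a
  coeff (a ∷ p) (suc k) = coeff p k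

  evalAt : Poly → Series → Series
  evalAt []      s = 0ₛ
  evalAt (a ∷ p) s = const a +ₛ s *ₛ evalAt p s

  DegreeAtMost : ℕ → Poly → Set ℓ
  DegreeAtMost d p = ∀ k → d ℕ.< k → coeff p k ≈ 0#

  HasDegree : ℕ → Poly → Set ℓ
  HasDegree d p = coeff p d ≉ 0# × DegreeAtMost d p

  -- tⁿ h(1/t) = Σ_{i ≤ n} hᵢ tⁿ⁻ⁱ, for h of degree at most n.
  reversed : ℕ → Poly → Series
  reversed n h = sumₛ {suc n} (λ i → const (coeff h (toℕ i)) *ₛ X ^ₛ (n ∸ toℕ i))

  Reciprocal : ℕ → Poly → Set ℓ
  Reciprocal n h = reversed n h ≋ coeff h

  -- h(t) = (1+t)ⁿ γ(t/(1+t)²) is an identity of rational functions whose only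
  -- denominators are powers of 1+t, so it is read in the ring of power series.
  IsGammaPolynomial : ℕ → Poly → Poly → Set ℓ
  IsGammaPolynomial n h γ =
    DegreeAtMost ⌊ n /2⌋ γ ×
    coeff h ≋ (1ₛ +ₛ X) ^ₛ n *ₛ evalAt γ (X *ₛ 1/[1+X] ^ₛ 2)

-- Put w = u/(1+u)², so J = γ(w).  With θ = u d/du, the right-hand side is the value at J of
-- the linear functional Φ r f = [uʳ] θf (1+u)²ʳ, so it suffices that Φ r (wʲ) = r if j = r and
-- 0 otherwise.  As θ(wʲ) = j wʲ (1-u)/(1+u), this is j [uᵐ] (1-u)(1+u)²ᵐ⁻¹ with m = r - j,
-- which vanishes for m > 0 because (1+u)²ᵐ⁻¹ has equal middle coefficients.
module Submission where

open import Algebra.Bundles using (CommutativeRing)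
import Algebra.Definitions.RawSemiring as RawSemiringDefs
import Algebra.Properties.AbelianGroup as AbelianGroupProperties
import Algebra.Properties.CommutativeMonoid.Mult as CommutativeMonoidMult
import Algebra.Properties.CommutativeSemigroup as CommutativeSemigroupProperties
import Algebra.Properties.CommutativeSemiring.Exp as CommutativeSemiringExp
import Algebra.Properties.Monoid.Mult as MonoidMult
import Algebra.Properties.Ring as RingProperties
import Algebra.Properties.Semiring.Exp as SemiringExp
import Algebra.Properties.Semiring.Mult as SemiringMult
open import Data.List.Base using ([]; _∷_)
open import Data.Nat.Base as ℕ using (ℕ; zero; suc; _≤_; _<_; _∸_; s<s) renaming (_*_ to _*ℕ_)
open import Data.Nat.Combinatorics using (_C_; nCk+nC[k+1]≡[n+1]C[k+1]; nCk≡nC[n∸k])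
import Data.Nat.Properties as ℕₚ
open import Data.Product.Base using (_,_)
open import Data.Sum.Base using (inj₁; inj₂)
open import Function.Base using (_∘_)
open import Level using (Level)
open import Relation.Binary.PropositionalEquality as ≡ using ()
import Relation.Binary.Reasoning.Setoid as SetoidReasoning
open import Defs

module SeriesProperties {c ℓ : Level} (R : CommutativeRing c ℓ) where

  open CommutativeRing R hiding (zero)
  open PowerSeries R
  open SetoidReasoning setoid
  open CommutativeSemigroupProperties +-commutativeSemigroup
    using (interchange; x∙yz≈y∙xz)
  open MonoidMult +-monoid using (×-congʳ; ×-congˡ; ×-homo-+)
  open CommutativeMonoidMult +-commutativeMonoid using (×-distrib-+)
  open SemiringMult semiring using (×-comm-*)

  -- The commutative ring of formal power series.

  private
    -- The product unfolds definitionally: `(f *ₛ g) (suc k)` is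
    -- `f 0 * g (suc k) + (tail f *ₛ g) k`. Hence the ring laws follow by induction on the
    -- coefficient index, with the first factor left free to become its tail.
    tail : Series → Series
    tail f = f ∘ suc

  *ₛ-cong : ∀ {f f′ g g′} → f ≋ f′ → g ≋ g′ → f *ₛ g ≋ f′ *ₛ g′
  *ₛ-cong p q zero    = +-congʳ (*-cong (p 0) (q 0))
  *ₛ-cong p q (suc k) = +-cong (*-cong (p 0) (q (suc k))) (*ₛ-cong (p ∘ suc) q k)

  *ₛ-zeroˡ : ∀ f → 0ₛ *ₛ f ≋ 0ₛ
  *ₛ-zeroˡ f zero    = trans (+-identityʳ _) (zeroˡ _)
  *ₛ-zeroˡ f (suc k) = trans (+-cong (zeroˡ _) (*ₛ-zeroˡ f k)) (+-identityʳ 0#)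

  const-*ₛ : ∀ a f k → (const a *ₛ f) k ≈ a * f k
  const-*ₛ a f zero    = +-identityʳ _
  const-*ₛ a f (suc k) = trans (+-congˡ (*ₛ-zeroˡ f k)) (+-identityʳ _)

  *ₛ-identityˡ : ∀ f → 1ₛ *ₛ f ≋ f
  *ₛ-identityˡ f k = trans (const-*ₛ 1# f k) (*-identityˡ _)

  *ₛ-distribʳ-+ₛ : ∀ f g h → (g +ₛ h) *ₛ f ≋ g *ₛ f +ₛ h *ₛ f
  *ₛ-distribʳ-+ₛ f g h zero = begin
    (g 0 + h 0) * f 0 + 0#                ≈⟨ +-cong (distribʳ _ _ _) (sym (+-identityʳ 0#)) ⟩
    (g 0 * f 0 + h 0 * f 0) + (0# + 0#)   ≈⟨ interchange _ _ _ _ ⟩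
    (g 0 * f 0 + 0#) + (h 0 * f 0 + 0#)   ∎
  *ₛ-distribʳ-+ₛ f g h (suc k) =
    trans (+-cong (distribʳ _ _ _) (*ₛ-distribʳ-+ₛ f (tail g) (tail h) k)) (interchange _ _ _ _)

  -- Mirror image of the definitional unfolding: it splits off the term with `g 0` instead of the
  -- one with `f 0`. Commutativity matches the two.
  *ₛ-unfoldʳ : ∀ f g k → (f *ₛ g) (suc k) ≈ f (suc k) * g 0 + (f *ₛ tail g) k
  *ₛ-unfoldʳ f g zero = begin
    f 0 * g 1 + (f 1 * g 0 + 0#)   ≈⟨ x∙yz≈y∙xz _ _ _ ⟩
    f 1 * g 0 + (f 0 * g 1 + 0#)   ∎
  *ₛ-unfoldʳ f g (suc k) = trans (+-congˡ (*ₛ-unfoldʳ (tail f) g k)) (x∙yz≈y∙xz _ _ _)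

  *ₛ-comm : ∀ f g → f *ₛ g ≋ g *ₛ f
  *ₛ-comm f g zero    = +-congʳ (*-comm _ _)
  *ₛ-comm f g (suc k) = trans
    (+-cong (*-comm _ _) (*ₛ-comm (tail f) g k)) (sym (*ₛ-unfoldʳ g f k))

  private
    scale-*ₛ : ∀ a f g → (λ k → a * f k) *ₛ g ≋ (λ k → a * (f *ₛ g) k)
    scale-*ₛ a f g zero = begin
      a * f 0 * g 0 + 0#     ≈⟨ +-identityʳ _ ⟩
      a * f 0 * g 0          ≈⟨ *-assoc _ _ _ ⟩
      a * (f 0 * g 0)        ≈⟨ *-congˡ (+-identityʳ _) ⟨
      a * (f 0 * g 0 + 0#)   ∎
    scale-*ₛ a f g (suc k) =
      trans (+-cong (*-assoc _ _ _) (scale-*ₛ a (tail f) g k)) (sym (distribˡ _ _ _))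

  *ₛ-assoc : ∀ f g h → (f *ₛ g) *ₛ h ≋ f *ₛ (g *ₛ h)
  *ₛ-assoc f g h zero = begin
    (f 0 * g 0 + 0#) * h 0 + 0#   ≈⟨ +-congʳ (*-congʳ (+-identityʳ _)) ⟩
    f 0 * g 0 * h 0 + 0#          ≈⟨ +-congʳ (*-assoc _ _ _) ⟩
    f 0 * (g 0 * h 0) + 0#        ≈⟨ +-congʳ (*-congˡ (+-identityʳ _)) ⟨
    f 0 * (g 0 * h 0 + 0#) + 0#   ∎
  *ₛ-assoc f g h (suc k) = begin
    -- Here `tail (f *ₛ g)` has unfolded to a scalar multiple of `tail g` plus `tail f *ₛ g`; the
    -- induction hypothesis applies to the second summand.
    (f 0 * g 0 + 0#) * h (suc k) + (((λ i → f 0 * g (suc i)) +ₛ tail f *ₛ g) *ₛ h) k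
      ≈⟨ +-cong (trans (*-congʳ (+-identityʳ _)) (*-assoc _ _ _)) (*ₛ-distribʳ-+ₛ h (λ i → f 0 * g (suc i)) (tail f *ₛ g) k) ⟩
    f 0 * (g 0 * h (suc k)) + (((λ i → f 0 * g (suc i)) *ₛ h) k + ((tail f *ₛ g) *ₛ h) k)
      ≈⟨ +-congˡ (+-cong (scale-*ₛ (f 0) (tail g) h k) (*ₛ-assoc (tail f) g h k)) ⟩
    f 0 * (g 0 * h (suc k)) + (f 0 * (tail g *ₛ h) k + (tail f *ₛ (g *ₛ h)) k)
      ≈⟨ +-assoc _ _ _ ⟨
    f 0 * (g 0 * h (suc k)) + f 0 * (tail g *ₛ h) k + (tail f *ₛ (g *ₛ h)) k
      ≈⟨ +-congʳ (distribˡ _ _ _) ⟨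
    f 0 * (g 0 * h (suc k) + (tail g *ₛ h) k) + (tail f *ₛ (g *ₛ h)) k
      ∎

  -- The operations agree with those of `seriesRawSemiring`, so the general laws of powers and
  -- multiples apply directly to `_^ₛ_` and `_·ₛ_`.
  seriesRing : CommutativeRing c ℓ
  seriesRing = record
    { Carrier = Series
    ; _≈_     = _≋_
    ; _+_     = _+ₛ_
    ; _*_     = _*ₛ_
    ; -_      = λ f k → - f k
    ; 0#      = 0ₛ
    ; 1#      = 1ₛ
    ; isCommutativeRing = record
      { isRing = record
        { +-isAbelianGroup = record
          { isGroup = record
            { isMonoid = record
              { isSemigroup = record
                { isMagma = record
                  { isEquivalence = record
                    { refl  = λ _ → refl
                    ; sym   = λ p k → sym (p k)
                    ; trans = λ p q k → trans (p k) (q k)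
                    }
                  ; ∙-cong = λ p q k → +-cong (p k) (q k)
                  }
                ; assoc = λ f g h k → +-assoc (f k) (g k) (h k)
                }
              ; identity = (λ f k → +-identityˡ (f k)) , (λ f k → +-identityʳ (f k))
              }
            ; inverse = (λ f k → -‿inverseˡ (f k)) , (λ f k → -‿inverseʳ (f k))
            ; ⁻¹-cong = λ p k → -‿cong (p k)
            }
          ; comm = λ f g k → +-comm (f k) (g k)
          }
        ; *-cong     = *ₛ-cong
        ; *-assoc    = *ₛ-assoc
        ; *-identity = *ₛ-identityˡ , λ f k → trans (*ₛ-comm f 1ₛ k) (*ₛ-identityˡ f k)
        ; distrib    = (λ f g h k → begin
            (f *ₛ (g +ₛ h)) k             ≈⟨ *ₛ-comm f (g +ₛ h) k ⟩
            ((g +ₛ h) *ₛ f) k             ≈⟨ *ₛ-distribʳ-+ₛ f g h k ⟩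
            (g *ₛ f) k + (h *ₛ f) k       ≈⟨ +-cong (*ₛ-comm g f k) (*ₛ-comm h f k) ⟩
            (f *ₛ g) k + (f *ₛ h) k       ∎)
          , *ₛ-distribʳ-+ₛ
        }
      ; *-comm = *ₛ-comm
      }
    }

  module 𝕊 = CommutativeRing seriesRing
  module ≋-Reasoning = SetoidReasoning 𝕊.setoid
  open CommutativeSemigroupProperties 𝕊.*-commutativeSemigroup
    using () renaming (x∙yz≈yx∙z to f∙gh≋gf∙h; xy∙z≈xz∙y to fg∙h≋fh∙g)
  open SemiringExp 𝕊.semiring using (^-homo-*; ^-assocʳ; ^-congˡ)
  open CommutativeSemiringExp 𝕊.commutativeSemiring using (^-distrib-*)
  open RawSemiringDefs seriesRawSemiring using () renaming (_×_ to infixr 8 _·ₛ_)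
  open SemiringMult 𝕊.semiring using () renaming (×-assoc-* to ·ₛ-assoc-*ₛ)
  open RingProperties 𝕊.ring using (-‿distribˡ-*)

  -- The Euler operator and logarithmic derivatives.

  θ : Series → Series
  θ f k = k · f k

  θ-cong : ∀ {f g} → f ≋ g → θ f ≋ θ g
  θ-cong p k = ×-congʳ k (p k)

  θ-+ₛ : ∀ f g → θ (f +ₛ g) ≋ θ f +ₛ θ g
  θ-+ₛ f g k = ×-distrib-+ (f k) (g k) k

  θ-const : ∀ a → θ (const a) ≋ 0ₛ
  θ-const a zero    = refl
  θ-const a (suc k) = ×-zeroʳ (suc k)
    where
    ×-zeroʳ : ∀ n → n · 0# ≈ 0#
    ×-zeroʳ zero    = refl
    ×-zeroʳ (suc n) = trans (+-identityˡ _) (×-zeroʳ n)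

  θ-const-*ₛ : ∀ a f → θ (const a *ₛ f) ≋ const a *ₛ θ f
  θ-const-*ₛ a f k = begin
    k · (const a *ₛ f) k   ≈⟨ ×-congʳ k (const-*ₛ a f k) ⟩
    k · (a * f k)          ≈⟨ ×-comm-* k a (f k) ⟨
    a * k · f k            ≈⟨ const-*ₛ a (θ f) k ⟨
    (const a *ₛ θ f) k     ∎

  θ-X : θ X ≋ X
  θ-X zero          = refl
  θ-X (suc zero)    = +-identityʳ 1#
  θ-X (suc (suc k)) = θ-const 0# (suc (suc k))

  θ-*ₛ : ∀ f g → θ (f *ₛ g) ≋ θ f *ₛ g +ₛ f *ₛ θ g
  θ-*ₛ f g zero = sym (begin
    (0# * g 0 + 0#) + (f 0 * 0# + 0#)   ≈⟨ +-cong (+-identityʳ _) (+-identityʳ _) ⟩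
    0# * g 0 + f 0 * 0#                 ≈⟨ +-cong (zeroˡ _) (zeroʳ _) ⟩
    0# + 0#                             ≈⟨ +-identityʳ 0# ⟩
    0#                                  ∎)
  θ-*ₛ f g (suc k) = begin
    suc k · (f 0 * g (suc k) + (tail f *ₛ g) k)
      ≈⟨ ×-distrib-+ _ _ (suc k) ⟩
    suc k · (f 0 * g (suc k)) + ((tail f *ₛ g) k + θ (tail f *ₛ g) k)
      ≈⟨ +-cong (sym (×-comm-* (suc k) _ _)) (+-congˡ (θ-*ₛ (tail f) g k)) ⟩
    f 0 * θ g (suc k) + ((tail f *ₛ g) k + ((θ (tail f) *ₛ g) k + (tail f *ₛ θ g) k))
      ≈⟨ +-congˡ (+-assoc _ _ _) ⟨
    f 0 * θ g (suc k) + ((tail f *ₛ g) k + (θ (tail f) *ₛ g) k + (tail f *ₛ θ g) k)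
      -- Since `suc k · x` is `x + k · x`, the series `tail (θ f)` is definitionally
      -- `tail f +ₛ θ (tail f)`. This absorbs the extra `tail f *ₛ g` that the index shift produces.
      ≈⟨ +-congˡ (+-congʳ (*ₛ-distribʳ-+ₛ g (tail f) (θ (tail f)) k)) ⟨
    f 0 * θ g (suc k) + ((tail (θ f) *ₛ g) k + (tail f *ₛ θ g) k)
      ≈⟨ x∙yz≈y∙xz _ _ _ ⟩
    (tail (θ f) *ₛ g) k + (f 0 * θ g (suc k) + (tail f *ₛ θ g) k)
      ≈⟨ +-congʳ (trans (+-congʳ (zeroˡ _)) (+-identityˡ _)) ⟨
    (0# * g (suc k) + (tail (θ f) *ₛ g) k) + (f 0 * θ g (suc k) + (tail f *ₛ θ g) k)
      ∎

  infix 4 _HasLogDerivative_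

  -- The quotient θf/f with its denominator cleared, because it is needed for `X` and `w`, whose
  -- constant terms vanish.
  _HasLogDerivative_ : Series → Series → Set ℓ
  f HasLogDerivative a = θ f ≋ f *ₛ a

  logDerivative-*ₛ : ∀ {f g a b} → f HasLogDerivative a → g HasLogDerivative b →
                     f *ₛ g HasLogDerivative a +ₛ b
  logDerivative-*ₛ {f} {g} {a} {b} p q = S.begin
    θ (f *ₛ g)                        S.≈⟨ θ-*ₛ f g ⟩
    θ f *ₛ g +ₛ f *ₛ θ g              S.≈⟨ 𝕊.+-cong (𝕊.*-congʳ {g} p) (𝕊.*-congˡ {f} q) ⟩
    f *ₛ a *ₛ g +ₛ f *ₛ (g *ₛ b)      S.≈⟨ 𝕊.+-cong (fg∙h≋fh∙g f a g) (𝕊.sym (𝕊.*-assoc f g b)) ⟩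
    f *ₛ g *ₛ a +ₛ f *ₛ g *ₛ b        S.≈⟨ 𝕊.distribˡ (f *ₛ g) a b ⟨
    f *ₛ g *ₛ (a +ₛ b)                S.∎
    where module S = ≋-Reasoning

  logDerivative-^ₛ : ∀ {f a} n → f HasLogDerivative a → f ^ₛ n HasLogDerivative n ·ₛ a
  logDerivative-^ₛ zero    p = 𝕊.trans (θ-const 1#) (𝕊.sym (𝕊.zeroʳ 1ₛ))
  logDerivative-^ₛ (suc n) p = logDerivative-*ₛ p (logDerivative-^ₛ n p)

  logDerivative-X : X HasLogDerivative 1ₛ
  logDerivative-X = 𝕊.trans θ-X (𝕊.sym (𝕊.*-identityʳ X))

  -- Powers of `X` as shifts, and binomial coefficients as coefficients of powers of `1+X`.

  X*ₛ-zero : ∀ f → (X *ₛ f) 0 ≈ 0#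
  X*ₛ-zero f = trans (+-identityʳ _) (zeroˡ _)

  X*ₛ-suc : ∀ f k → (X *ₛ f) (suc k) ≈ f k
  X*ₛ-suc f k = trans (+-congʳ (zeroˡ _)) (trans (+-identityˡ _) (*ₛ-identityˡ f k))

  X^ₛ*ₛ-< : ∀ {j k} f → k < j → (X ^ₛ j *ₛ f) k ≈ 0#
  X^ₛ*ₛ-< {suc j} {zero}  f k<j       = trans (*ₛ-assoc X (X ^ₛ j) f 0) (X*ₛ-zero (X ^ₛ j *ₛ f))
  X^ₛ*ₛ-< {suc j} {suc k} f (s<s k<j) =
    trans (*ₛ-assoc X (X ^ₛ j) f (suc k)) (trans (X*ₛ-suc (X ^ₛ j *ₛ f) k) (X^ₛ*ₛ-< f k<j))

  X^ₛ*ₛ-+ : ∀ j k f → (X ^ₛ j *ₛ f) (j ℕ.+ k) ≈ f k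
  X^ₛ*ₛ-+ zero    k f = *ₛ-identityˡ f k
  X^ₛ*ₛ-+ (suc j) k f =
    trans (*ₛ-assoc X (X ^ₛ j) f (suc j ℕ.+ k)) (trans (X*ₛ-suc (X ^ₛ j *ₛ f) (j ℕ.+ k)) (X^ₛ*ₛ-+ j k f))

  -- The series `w` is, by definition, the argument at which `IsGammaPolynomial` evaluates its
  -- polynomial.
  1+X 1-X v w : Series
  1+X = 1ₛ +ₛ X
  1-X = 1ₛ 𝕊.- X
  v   = 1/[1+X]
  w   = X *ₛ v ^ₛ 2

  -- Multiplication by `1+X` adds neighbouring coefficients, which is Pascal's rule.
  [1+X]^ₛ-coeff : ∀ n k → (1+X ^ₛ n) k ≈ (n C k) · 1#
  [1+X]^ₛ-coeff zero    zero    = sym (+-identityʳ 1#)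
  [1+X]^ₛ-coeff zero    (suc k) = refl
  [1+X]^ₛ-coeff (suc n) zero    = begin
    (1# + 0#) * (1+X ^ₛ n) 0 + 0#   ≈⟨ +-identityʳ _ ⟩
    (1# + 0#) * (1+X ^ₛ n) 0        ≈⟨ *-cong (+-identityʳ 1#) ([1+X]^ₛ-coeff n 0) ⟩
    1# * ((n C 0) · 1#)             ≈⟨ *-identityˡ _ ⟩
    (suc n C 0) · 1#                ∎
  [1+X]^ₛ-coeff (suc n) (suc k) = begin
    ((1ₛ +ₛ X) *ₛ 1+X ^ₛ n) (suc k)
      ≈⟨ *ₛ-distribʳ-+ₛ (1+X ^ₛ n) 1ₛ X (suc k) ⟩
    (1ₛ *ₛ 1+X ^ₛ n) (suc k) + (X *ₛ 1+X ^ₛ n) (suc k)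
      ≈⟨ +-cong (*ₛ-identityˡ (1+X ^ₛ n) (suc k)) (X*ₛ-suc (1+X ^ₛ n) k) ⟩
    (1+X ^ₛ n) (suc k) + (1+X ^ₛ n) k
      ≈⟨ +-comm _ _ ⟩
    (1+X ^ₛ n) k + (1+X ^ₛ n) (suc k)
      ≈⟨ +-cong ([1+X]^ₛ-coeff n k) ([1+X]^ₛ-coeff n (suc k)) ⟩
    (n C k) · 1# + (n C suc k) · 1#
      ≈⟨ ×-homo-+ 1# (n C k) (n C suc k) ⟨
    (n C k ℕ.+ n C suc k) · 1#
      ≈⟨ ×-congˡ (nCk+nC[k+1]≡[n+1]C[k+1] n k) ⟩
    (suc n C suc k) · 1#
      ∎

  -- The exponent is the odd number 2m+1, so `m` and `suc m` are complementary indices and the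
  -- symmetry of binomial coefficients applies.
  [1+X]^ₛ-middle : ∀ m → let n = m ℕ.+ suc m in (1+X ^ₛ n) (suc m) ≈ (1+X ^ₛ n) m
  [1+X]^ₛ-middle m = begin
    (1+X ^ₛ n) (suc m)   ≈⟨ [1+X]^ₛ-coeff n (suc m) ⟩
    (n C suc m) · 1#     ≈⟨ ×-congˡ (≡.cong (n C_) (ℕₚ.m+n∸m≡n m (suc m))) ⟨
    (n C (n ∸ m)) · 1#   ≈⟨ ×-congˡ (nCk≡nC[n∸k] (ℕₚ.m≤m+n m (suc m))) ⟨
    (n C m) · 1#         ≈⟨ [1+X]^ₛ-coeff n m ⟨
    (1+X ^ₛ n) m         ∎
    where n = m ℕ.+ suc m

  [1-X]*ₛ-suc : ∀ f k → (1-X *ₛ f) (suc k) ≈ f (suc k) - f k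
  [1-X]*ₛ-suc f k = begin
    (1-X *ₛ f) (suc k)
      ≈⟨ *ₛ-distribʳ-+ₛ f 1ₛ (𝕊.- X) (suc k) ⟩
    (1ₛ *ₛ f) (suc k) + ((𝕊.- X) *ₛ f) (suc k)
      ≈⟨ +-cong (*ₛ-identityˡ f (suc k)) (𝕊.sym (-‿distribˡ-* X f) (suc k)) ⟩
    f (suc k) - (X *ₛ f) (suc k)
      ≈⟨ +-congˡ (-‿cong (X*ₛ-suc f k)) ⟩
    f (suc k) - f k
      ∎

  -- The logarithmic derivative (1-u)/(1+u) of `w`, and its products with even powers of `1+X`.

  q : Series
  q = 1-X *ₛ v

  v*ₛ1+X : v *ₛ 1+X ≋ 1ₛ
  v*ₛ1+X = 𝕊.trans (*ₛ-comm v 1+X) 1+X-inverse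

  v^ₛ*ₛ[1+X]^ₛ : ∀ n → v ^ₛ n *ₛ 1+X ^ₛ n ≋ 1ₛ
  v^ₛ*ₛ[1+X]^ₛ n = 𝕊.trans (𝕊.sym (^-distrib-* v 1+X n)) (𝕊.trans (^-congˡ n v*ₛ1+X) (1^ n))
    where
    1^ : ∀ n → 1ₛ ^ₛ n ≋ 1ₛ
    1^ zero    = 𝕊.refl
    1^ (suc n) = 𝕊.trans (*ₛ-identityˡ _) (1^ n)

  -- Applying `θ` to (1+X)v = 1 gives Xv + (1+X)θv = 0; multiplying (1+X)θv = -Xv by `v` isolates
  -- θv.
  logDerivative-v : v HasLogDerivative 𝕊.- (X *ₛ v)
  logDerivative-v = S.begin
    θ v                          S.≈⟨ *ₛ-identityˡ (θ v) ⟨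
    1ₛ *ₛ θ v                    S.≈⟨ 𝕊.*-congʳ v*ₛ1+X ⟨
    v *ₛ 1+X *ₛ θ v              S.≈⟨ *ₛ-assoc v 1+X (θ v) ⟩
    v *ₛ (1+X *ₛ θ v)            S.≈⟨ 𝕊.*-congˡ {v} (inverseʳ-unique (X *ₛ v) (1+X *ₛ θ v) Xv+[1+X]θv≋0) ⟩
    v *ₛ 𝕊.- (X *ₛ v)            S.∎
    where
    module S = ≋-Reasoning
    open AbelianGroupProperties 𝕊.+-abelianGroup using (inverseʳ-unique)

    θ-1+X : θ 1+X ≋ X
    θ-1+X = 𝕊.trans (θ-+ₛ 1ₛ X) (𝕊.trans (𝕊.+-cong (θ-const 1#) θ-X) (𝕊.+-identityˡ X))

    Xv+[1+X]θv≋0 : X *ₛ v +ₛ 1+X *ₛ θ v ≋ 0ₛ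
    Xv+[1+X]θv≋0 = S.begin
      X *ₛ v +ₛ 1+X *ₛ θ v          S.≈⟨ 𝕊.+-congʳ (𝕊.*-congʳ θ-1+X) ⟨
      θ 1+X *ₛ v +ₛ 1+X *ₛ θ v      S.≈⟨ θ-*ₛ 1+X v ⟨
      θ (1+X *ₛ v)                  S.≈⟨ θ-cong 1+X-inverse ⟩
      θ 1ₛ                          S.≈⟨ θ-const 1# ⟩
      0ₛ                            S.∎

  -- The product and power rules applied to Xv² give 1 - 2Xv. Since (1+X)v = 1 means 1 - Xv = v,
  -- this equals v - Xv = (1-X)v.
  logDerivative-w : w HasLogDerivative q
  logDerivative-w = 𝕊.trans
    (logDerivative-*ₛ logDerivative-X (logDerivative-^ₛ 2 logDerivative-v))
    (𝕊.*-congˡ {w} 1-2Xv≋q)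
    where
    module S = ≋-Reasoning
    Xv = X *ₛ v

    1-Xv≋v : 1ₛ 𝕊.- Xv ≋ v
    1-Xv≋v = S.begin
      1ₛ 𝕊.- Xv                  S.≈⟨ 𝕊.+-congʳ 1+X-inverse ⟨
      1+X *ₛ v 𝕊.- Xv            S.≈⟨ 𝕊.+-congʳ (𝕊.distribʳ v 1ₛ X) ⟩
      1ₛ *ₛ v +ₛ Xv 𝕊.- Xv       S.≈⟨ 𝕊.+-assoc (1ₛ *ₛ v) Xv (𝕊.- Xv) ⟩
      1ₛ *ₛ v +ₛ (Xv 𝕊.- Xv)     S.≈⟨ 𝕊.+-cong (*ₛ-identityˡ v) (𝕊.-‿inverseʳ Xv) ⟩
      v +ₛ 0ₛ                    S.≈⟨ 𝕊.+-identityʳ v ⟩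
      v                          S.∎

    1-2Xv≋q : 1ₛ +ₛ 2 ·ₛ (𝕊.- Xv) ≋ q
    1-2Xv≋q = S.begin
      1ₛ +ₛ (𝕊.- Xv +ₛ (𝕊.- Xv +ₛ 0ₛ))   S.≈⟨ 𝕊.+-congˡ {1ₛ} (𝕊.+-congˡ {𝕊.- Xv} (𝕊.+-identityʳ (𝕊.- Xv))) ⟩
      1ₛ +ₛ (𝕊.- Xv +ₛ 𝕊.- Xv)           S.≈⟨ 𝕊.+-assoc 1ₛ (𝕊.- Xv) (𝕊.- Xv) ⟨
      1ₛ 𝕊.- Xv 𝕊.- Xv                   S.≈⟨ 𝕊.+-cong (𝕊.trans 1-Xv≋v (𝕊.sym (*ₛ-identityˡ v))) (-‿distribˡ-* X v) ⟩
      1ₛ *ₛ v +ₛ (𝕊.- X) *ₛ v            S.≈⟨ 𝕊.distribʳ v 1ₛ (𝕊.- X) ⟨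
      q                                  S.∎

  -- Here `1ₛ m` acts as a Kronecker delta. For positive `m` the factor `v` cancels one `1+X`, and
  -- multiplication by `1-X` then takes the difference of the two middle coefficients of an odd
  -- power.
  q*ₛ[1+X]^ₛ-coeff : ∀ m → (q *ₛ 1+X ^ₛ (2 *ℕ m)) m ≈ 1ₛ m
  q*ₛ[1+X]^ₛ-coeff zero = begin
    ((1# - 0#) * 1# + 0#) * 1# + 0#   ≈⟨ trans (+-identityʳ _) (*-identityʳ _) ⟩
    (1# - 0#) * 1# + 0#               ≈⟨ trans (+-identityʳ _) (*-identityʳ _) ⟩
    1# - 0#                           ≈⟨ +-congˡ ε⁻¹≈ε ⟩
    1# + 0#                           ≈⟨ +-identityʳ 1# ⟩
    1#                                ∎
    where open AbelianGroupProperties +-abelianGroup using (ε⁻¹≈ε)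
  q*ₛ[1+X]^ₛ-coeff (suc m) = begin
    -- The exponent `2 *ℕ suc m` has reduced to a successor, which exposes the factor `1+X` to be
    -- cancelled. Removing the leftover `ℕ.+ 0` brings the remaining exponent to the form in
    -- `[1+X]^ₛ-middle`.
    (1-X *ₛ v *ₛ (1+X *ₛ 1+X ^ₛ (m ℕ.+ suc (m ℕ.+ 0)))) (suc m)
      ≡⟨ ≡.cong (λ i → (1-X *ₛ v *ₛ (1+X *ₛ 1+X ^ₛ (m ℕ.+ suc i))) (suc m)) (ℕₚ.+-identityʳ m) ⟩
    (1-X *ₛ v *ₛ (1+X *ₛ P)) (suc m)
      ≈⟨ cancel (suc m) ⟩
    (1-X *ₛ P) (suc m)
      ≈⟨ [1-X]*ₛ-suc P m ⟩
    P (suc m) - P m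
      ≈⟨ +-congʳ ([1+X]^ₛ-middle m) ⟩
    P m - P m
      ≈⟨ -‿inverseʳ (P m) ⟩
    0#
      ∎
    where
    P = 1+X ^ₛ (m ℕ.+ suc m)

    cancel : 1-X *ₛ v *ₛ (1+X *ₛ P) ≋ 1-X *ₛ P
    cancel = S.begin
      1-X *ₛ v *ₛ (1+X *ₛ P)     S.≈⟨ *ₛ-assoc 1-X v (1+X *ₛ P) ⟩
      1-X *ₛ (v *ₛ (1+X *ₛ P))   S.≈⟨ 𝕊.*-congˡ {1-X} (*ₛ-assoc v 1+X P) ⟨
      1-X *ₛ (v *ₛ 1+X *ₛ P)     S.≈⟨ 𝕊.*-congˡ {1-X} (𝕊.trans (𝕊.*-congʳ v*ₛ1+X) (*ₛ-identityˡ P)) ⟩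
      1-X *ₛ P                   S.∎
      where module S = ≋-Reasoning

  -- The functional `Φ r` and its values on powers of `w`.

  ·ₛ-coeff : ∀ n f k → (n ·ₛ f) k ≈ n · f k
  ·ₛ-coeff zero    f k = refl
  ·ₛ-coeff (suc n) f k = +-congˡ (·ₛ-coeff n f k)

  -- For r ≥ 1 this is [uʳ⁻¹] f′ (1+u)²ʳ.
  Φ : ℕ → Series → Carrier
  Φ r f = (θ f *ₛ 1+X ^ₛ (2 *ℕ r)) r

  Φ-cong : ∀ r {f g} → f ≋ g → Φ r f ≈ Φ r g
  Φ-cong r p = 𝕊.*-congʳ {1+X ^ₛ (2 *ℕ r)} (θ-cong p) r

  Φ-+ₛ : ∀ r f g → Φ r (f +ₛ g) ≈ Φ r f + Φ r g
  Φ-+ₛ r f g = trans (𝕊.*-congʳ {1+X ^ₛ (2 *ℕ r)} (θ-+ₛ f g) r) (*ₛ-distribʳ-+ₛ (1+X ^ₛ (2 *ℕ r)) (θ f) (θ g) r)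

  Φ-const-*ₛ : ∀ r a f → Φ r (const a *ₛ f) ≈ a * Φ r f
  Φ-const-*ₛ r a f = begin
    (θ (const a *ₛ f) *ₛ P) r   ≈⟨ 𝕊.*-congʳ {P} (θ-const-*ₛ a f) r ⟩
    (const a *ₛ θ f *ₛ P) r     ≈⟨ *ₛ-assoc (const a) (θ f) P r ⟩
    (const a *ₛ (θ f *ₛ P)) r   ≈⟨ const-*ₛ a (θ f *ₛ P) r ⟩
    a * Φ r f                   ∎
    where P = 1+X ^ₛ (2 *ℕ r)

  w^ₛ≋X^ₛ*ₛv^ₛ : ∀ j → w ^ₛ j ≋ X ^ₛ j *ₛ v ^ₛ (2 *ℕ j)
  w^ₛ≋X^ₛ*ₛv^ₛ j = 𝕊.trans (^-distrib-* X (v ^ₛ 2) j) (𝕊.*-congˡ {X ^ₛ j} (^-assocʳ v 2 j))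

  -- The denominator (1+u)²ʲ of wʲ cancels against 2j of the 2(j+m) factors `1+X`. The remaining Xʲ
  -- turns a question about coefficient j+m into the same question about coefficient m.
  w^ₛ*ₛ[1+X]^ₛ : ∀ j m → w ^ₛ j *ₛ 1+X ^ₛ (2 *ℕ (j ℕ.+ m)) ≋ X ^ₛ j *ₛ 1+X ^ₛ (2 *ℕ m)
  w^ₛ*ₛ[1+X]^ₛ j m = S.begin
    w ^ₛ j *ₛ 1+X ^ₛ (2 *ℕ (j ℕ.+ m))
      S.≡⟨ ≡.cong (λ i → w ^ₛ j *ₛ 1+X ^ₛ i) (ℕₚ.*-distribˡ-+ 2 j m) ⟩
    w ^ₛ j *ₛ 1+X ^ₛ (2 *ℕ j ℕ.+ 2 *ℕ m)
      S.≈⟨ 𝕊.*-cong (w^ₛ≋X^ₛ*ₛv^ₛ j) (^-homo-* 1+X (2 *ℕ j) (2 *ℕ m)) ⟩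
    X ^ₛ j *ₛ V *ₛ (P *ₛ Q)
      S.≈⟨ *ₛ-assoc (X ^ₛ j) V (P *ₛ Q) ⟩
    X ^ₛ j *ₛ (V *ₛ (P *ₛ Q))
      S.≈⟨ 𝕊.*-congˡ {X ^ₛ j} (*ₛ-assoc V P Q) ⟨
    X ^ₛ j *ₛ (V *ₛ P *ₛ Q)
      S.≈⟨ 𝕊.*-congˡ {X ^ₛ j} (𝕊.*-congʳ {Q} (v^ₛ*ₛ[1+X]^ₛ (2 *ℕ j))) ⟩
    X ^ₛ j *ₛ (1ₛ *ₛ Q)
      S.≈⟨ 𝕊.*-congˡ {X ^ₛ j} (*ₛ-identityˡ Q) ⟩
    X ^ₛ j *ₛ Q
      S.∎
    where
    module S = ≋-Reasoning
    V = v ^ₛ (2 *ℕ j)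
    P = 1+X ^ₛ (2 *ℕ j)
    Q = 1+X ^ₛ (2 *ℕ m)

  -- The right-hand side encodes the value r for j = r and 0 otherwise. In this form it is again a
  -- linear functional, applied to `X ^ₛ j` in place of `w ^ₛ j`, so the equality extends to
  -- polynomials by linearity.
  Φ-w^ₛ : ∀ r j → Φ r (w ^ₛ j) ≈ θ (X ^ₛ j) r
  Φ-w^ₛ r j = begin
    (θ (w ^ₛ j) *ₛ P) r         ≈⟨ 𝕊.*-congʳ {P} (logDerivative-^ₛ j logDerivative-w) r ⟩
    (w ^ₛ j *ₛ j ·ₛ q *ₛ P) r   ≈⟨ coefficient (ℕₚ.≤-<-connex j r) ⟩
    (X ^ₛ j *ₛ j ·ₛ 1ₛ) r       ≈⟨ logDerivative-^ₛ j logDerivative-X r ⟨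
    θ (X ^ₛ j) r                ∎
    where
    P = 1+X ^ₛ (2 *ℕ r)
    coefficient : _ → (w ^ₛ j *ₛ j ·ₛ q *ₛ P) r ≈ (X ^ₛ j *ₛ j ·ₛ 1ₛ) r
    -- Both sides are multiples of Xʲ, so their coefficients below index j vanish.
    coefficient (inj₂ r<j) = begin
      (w ^ₛ j *ₛ j ·ₛ q *ₛ P) r
        ≈⟨ *ₛ-assoc (w ^ₛ j) (j ·ₛ q) P r ⟩
      (w ^ₛ j *ₛ (j ·ₛ q *ₛ P)) r
        ≈⟨ 𝕊.*-congʳ {j ·ₛ q *ₛ P} (w^ₛ≋X^ₛ*ₛv^ₛ j) r ⟩
      (X ^ₛ j *ₛ v ^ₛ (2 *ℕ j) *ₛ (j ·ₛ q *ₛ P)) r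
        ≈⟨ *ₛ-assoc (X ^ₛ j) (v ^ₛ (2 *ℕ j)) (j ·ₛ q *ₛ P) r ⟩
      (X ^ₛ j *ₛ (v ^ₛ (2 *ℕ j) *ₛ (j ·ₛ q *ₛ P))) r
        ≈⟨ X^ₛ*ₛ-< (v ^ₛ (2 *ℕ j) *ₛ (j ·ₛ q *ₛ P)) r<j ⟩
      0#
        ≈⟨ X^ₛ*ₛ-< (j ·ₛ 1ₛ) r<j ⟨
      (X ^ₛ j *ₛ j ·ₛ 1ₛ) r
        ∎
    -- With r = j + m, removing Xʲ from both sides leaves coefficient m, and each becomes
    -- `j · 1ₛ m`.
    coefficient (inj₁ j≤r) with m , ≡.refl ← ℕₚ.m≤n⇒∃[o]m+o≡n j≤r = begin
      (w ^ₛ j *ₛ j ·ₛ q *ₛ P) (j ℕ.+ m)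
        ≈⟨ fg∙h≋fh∙g (w ^ₛ j) (j ·ₛ q) P (j ℕ.+ m) ⟩
      (w ^ₛ j *ₛ P *ₛ j ·ₛ q) (j ℕ.+ m)
        ≈⟨ 𝕊.*-congʳ {j ·ₛ q} (w^ₛ*ₛ[1+X]^ₛ j m) (j ℕ.+ m) ⟩
      (X ^ₛ j *ₛ Q *ₛ j ·ₛ q) (j ℕ.+ m)
        ≈⟨ *ₛ-assoc (X ^ₛ j) Q (j ·ₛ q) (j ℕ.+ m) ⟩
      (X ^ₛ j *ₛ (Q *ₛ j ·ₛ q)) (j ℕ.+ m)
        ≈⟨ X^ₛ*ₛ-+ j m (Q *ₛ j ·ₛ q) ⟩
      (Q *ₛ j ·ₛ q) m
        ≈⟨ *ₛ-comm Q (j ·ₛ q) m ⟩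
      (j ·ₛ q *ₛ Q) m
        ≈⟨ ·ₛ-assoc-*ₛ j q Q m ⟩
      (j ·ₛ (q *ₛ Q)) m
        ≈⟨ ·ₛ-coeff j (q *ₛ Q) m ⟩
      j · (q *ₛ Q) m
        ≈⟨ ×-congʳ j (q*ₛ[1+X]^ₛ-coeff m) ⟩
      j · 1ₛ m
        ≈⟨ ·ₛ-coeff j 1ₛ m ⟨
      (j ·ₛ 1ₛ) m
        ≈⟨ X^ₛ*ₛ-+ j m (j ·ₛ 1ₛ) ⟨
      (X ^ₛ j *ₛ j ·ₛ 1ₛ) (j ℕ.+ m)
        ∎
      where Q = 1+X ^ₛ (2 *ℕ m)

  -- Linear extension from powers of `w` to polynomials in `w`.

  coeff-∷ : ∀ a p → coeff (a ∷ p) ≋ const a +ₛ X *ₛ coeff p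
  coeff-∷ a p zero    = sym (trans (+-congˡ (X*ₛ-zero (coeff p))) (+-identityʳ a))
  coeff-∷ a p (suc k) = sym (trans (+-identityˡ _) (X*ₛ-suc (coeff p) k))

  -- One Horner step behind a prefactor, used with `w` for `evalAt` and with `X` for `coeff`. The
  -- order `g *ₛ f` makes the new prefactor definitionally the next power.
  *ₛ-horner : ∀ f a g h → f *ₛ (const a +ₛ g *ₛ h) ≋ const a *ₛ f +ₛ g *ₛ f *ₛ h
  *ₛ-horner f a g h = 𝕊.trans (𝕊.distribˡ f (const a) (g *ₛ h))
    (𝕊.+-cong (*ₛ-comm f (const a)) (f∙gh≋gf∙h f g h))

  -- The powers of w are carried along so that the induction on p needs only Φ-w^ₛ and linearity.
  Φ-w^ₛ-evalAt : ∀ r j p → Φ r (w ^ₛ j *ₛ evalAt p w) ≈ θ (X ^ₛ j *ₛ coeff p) r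
  Φ-w^ₛ-evalAt r j [] = begin
    Φ r (w ^ₛ j *ₛ 0ₛ)           ≈⟨ Φ-cong r (*ₛ-0ₛ (w ^ₛ j)) ⟩
    Φ r (const 0# *ₛ 0ₛ)         ≈⟨ Φ-const-*ₛ r 0# 0ₛ ⟩
    0# * Φ r 0ₛ                  ≈⟨ zeroˡ _ ⟩
    0#                           ≈⟨ zeroˡ _ ⟨
    0# * θ 0ₛ r                  ≈⟨ const-*ₛ 0# (θ 0ₛ) r ⟨
    (const 0# *ₛ θ 0ₛ) r         ≈⟨ θ-const-*ₛ 0# 0ₛ r ⟨
    θ (const 0# *ₛ 0ₛ) r         ≈⟨ θ-cong (*ₛ-0ₛ (X ^ₛ j)) r ⟨
    θ (X ^ₛ j *ₛ 0ₛ) r           ∎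
    where
    -- Writing zero as a multiple by `const 0#` lets the scalar rules for `Φ` and `θ` show that both
    -- sides vanish.
    *ₛ-0ₛ : ∀ f → f *ₛ 0ₛ ≋ const 0# *ₛ 0ₛ
    *ₛ-0ₛ f = 𝕊.trans (𝕊.zeroʳ f) (𝕊.sym (𝕊.zeroʳ (const 0#)))
  Φ-w^ₛ-evalAt r j (a ∷ p) = begin
    Φ r (w ^ₛ j *ₛ (const a +ₛ w *ₛ E))
      ≈⟨ Φ-cong r (*ₛ-horner (w ^ₛ j) a w E) ⟩
    Φ r (const a *ₛ w ^ₛ j +ₛ w ^ₛ suc j *ₛ E)
      ≈⟨ Φ-+ₛ r (const a *ₛ w ^ₛ j) (w ^ₛ suc j *ₛ E) ⟩
    Φ r (const a *ₛ w ^ₛ j) + Φ r (w ^ₛ suc j *ₛ E)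
      ≈⟨ +-cong (trans (Φ-const-*ₛ r a (w ^ₛ j)) (*-congˡ (Φ-w^ₛ r j))) (Φ-w^ₛ-evalAt r (suc j) p) ⟩
    a * θ (X ^ₛ j) r + θ (X ^ₛ suc j *ₛ coeff p) r
      ≈⟨ +-congʳ (trans (θ-const-*ₛ a (X ^ₛ j) r) (const-*ₛ a (θ (X ^ₛ j)) r)) ⟨
    θ (const a *ₛ X ^ₛ j) r + θ (X ^ₛ suc j *ₛ coeff p) r
      ≈⟨ θ-+ₛ (const a *ₛ X ^ₛ j) (X ^ₛ suc j *ₛ coeff p) r ⟨
    θ (const a *ₛ X ^ₛ j +ₛ X ^ₛ suc j *ₛ coeff p) r
      ≈⟨ θ-cong (*ₛ-horner (X ^ₛ j) a X (coeff p)) r ⟨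
    θ (X ^ₛ j *ₛ (const a +ₛ X *ₛ coeff p)) r
      ≈⟨ θ-cong (𝕊.*-congˡ {X ^ₛ j} (coeff-∷ a p)) r ⟨
    θ (X ^ₛ j *ₛ coeff (a ∷ p)) r
      ∎
    where E = evalAt p w

  Φ-evalAt : ∀ r p → Φ r (evalAt p w) ≈ r · coeff p r
  Φ-evalAt r p = begin
    Φ r (evalAt p w)          ≈⟨ Φ-cong r (*ₛ-identityˡ (evalAt p w)) ⟨
    Φ r (1ₛ *ₛ evalAt p w)    ≈⟨ Φ-w^ₛ-evalAt r 0 p ⟩
    θ (1ₛ *ₛ coeff p) r       ≈⟨ θ-cong (*ₛ-identityˡ (coeff p)) r ⟩
    r · coeff p r             ∎

  -- From `Φ` back to the formal derivative, and from γ(w) to J.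

  Φ-deriv : ∀ k f → Φ (suc k) f ≈ (deriv f *ₛ (X +ₛ 1ₛ) ^ₛ (2 *ℕ suc k)) k
  Φ-deriv k f = begin
    -- The constant term of `θ f` is zero and its tail is definitionally `deriv f`; hence the index
    -- drops from `suc k` to `k`.
    0# * (1+X ^ₛ n) (suc k) + (deriv f *ₛ 1+X ^ₛ n) k   ≈⟨ trans (+-congʳ (zeroˡ _)) (+-identityˡ _) ⟩
    (deriv f *ₛ 1+X ^ₛ n) k                             ≈⟨ 𝕊.*-congˡ {deriv f} (^-congˡ n (𝕊.+-comm 1ₛ X)) k ⟩
    (deriv f *ₛ (X +ₛ 1ₛ) ^ₛ n) k                       ∎
    where n = 2 *ℕ suc k

  [1+X]^ₛ*ₛv^ₛ-cancel : ∀ n f → 1+X ^ₛ n *ₛ f *ₛ v ^ₛ n ≋ f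
  [1+X]^ₛ*ₛv^ₛ-cancel n f = S.begin
    1+X ^ₛ n *ₛ f *ₛ v ^ₛ n     S.≈⟨ *ₛ-comm (1+X ^ₛ n *ₛ f) (v ^ₛ n) ⟩
    v ^ₛ n *ₛ (1+X ^ₛ n *ₛ f)   S.≈⟨ *ₛ-assoc (v ^ₛ n) (1+X ^ₛ n) f ⟨
    v ^ₛ n *ₛ 1+X ^ₛ n *ₛ f     S.≈⟨ 𝕊.*-congʳ {f} (v^ₛ*ₛ[1+X]^ₛ n) ⟩
    1ₛ *ₛ f                     S.≈⟨ *ₛ-identityˡ f ⟩
    f                           S.∎
    where module S = ≋-Reasoning

theorem1p7 : ∀ {c ℓ} (R : CommutativeRing c ℓ) →
    let open CommutativeRing R using (_≈_) in
    let open PowerSeries R in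
    (n : ℕ) (h γ : Poly) →
    HasDegree n h →
    Reciprocal n h →
    IsGammaPolynomial n h γ →
    let J : Series
        J = coeff h *ₛ 1/[1+X] ^ₛ n
    in
    (r : ℕ) → 1 ≤ r →
    r · coeff γ r ≈ (deriv J *ₛ (X +ₛ 1ₛ) ^ₛ (2 *ℕ r)) (r ∸ 1)
theorem1p7 R n h γ _ _ (_ , h≋) (suc k) _ = begin
  suc k · coeff γ (suc k)                       ≈⟨ Φ-evalAt (suc k) γ ⟨
  Φ (suc k) (evalAt γ w)                        ≈⟨ Φ-cong (suc k) J≋γ[w] ⟨
  Φ (suc k) J                                   ≈⟨ Φ-deriv k J ⟩
  (deriv J *ₛ (X +ₛ 1ₛ) ^ₛ (2 *ℕ suc k)) k      ∎
  where
  open PowerSeries R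
  open SeriesProperties R
  open SetoidReasoning (CommutativeRing.setoid R)
  J = coeff h *ₛ v ^ₛ n

  -- Multiplying the identity between `h` and `γ` by `v ^ₛ n` clears the factor (1+X)ⁿ.
  J≋γ[w] : J ≋ evalAt γ w
  J≋γ[w] = 𝕊.trans (𝕊.*-congʳ {v ^ₛ n} h≋) ([1+X]^ₛ*ₛv^ₛ-cancel n (evalAt γ w))
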